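{- For every derivation in $\mathsf{SKS}$ with premise $T$ and conclusion $R$ there are structures $V$ and $U$ and a derivation from $T$ to $R$ composed, from top to bottom, of: a derivation from $T$ to $V$ in $\{ac{\uparrow}\}$, a derivation from $V$ to $U$ in $\mathsf{SKS}\setminus\{ac{\downarrow},ac{\uparrow}\}$, and a derivation from $U$ to $R$ in $\{ac{\downarrow}\}$.
   Context: Structures: generated by $S ::= \mathsf f \mid \mathsf t \mid a \mid [S,\dots,S] \mid (S,\dots,S) \mid \bar S$ (non-empty lists), where $a$ ranges over atoms, $\mathsf f,\mathsf t$ are the units false and true, $[\cdot]$ is disjunction, $(\cdot)$ is conjunction, $\bar S$ is negation; the negation of an atom is again an atom. A context $S\{\ \}$ is a structure with one occurrence of a hole, not in the scope of a negation; $S\{R\}$ is the result of filling it with $R$; $S[R,T]$ abbreviates $S\{[R,T]\}$ and $S(R,T)$ abbreviates $S\{(R,T)\}$. Equivalent structures are not distinguished; equivalence is the smallest equivalence relation induced by: $[\vec R,[\vec T],\vec U]=[\vec R,\vec T,\vec U]$ and $(\vec R,(\vec T),\vec U)=(\vec R,\vec T,\vec U)$ (with $\vec R,\vec T,\vec U$ finite sequences, $\vec T$ non-empty); $[R,T]=[T,R]$, $(R,T)=(T,R)$; $(\mathsf f,\mathsf f)=\mathsf f$, $[\mathsf f,R]=R$, $[\mathsf t,\mathsf t]=\mathsf t$, $(\mathsf t,R)=R$; $\bar{\mathsf f}=\mathsf t$, $\bar{\mathsf t}=\mathsf f$, $\overline{[R,T]}=(\bar R,\bar T)$, $\overline{(R,T)}=[\bar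 R,\bar T]$, $\bar{\bar R}=R$; and closure: if $R=T$ then $S\{R\}=S\{T\}$ and $\bar R=\bar T$. A derivation in a system (set of inference rules) is a finite sequence of rule instances, read top-down, the conclusion of each being the premise of the next; it may consist of a single structure. Its premise is the topmost structure, its conclusion the bottommost. System $\mathsf{SKS}$ has the rules (written $\frac{\text{premise}}{\text{conclusion}}$, for atoms $a$, structures $R,T,U,V$ and contexts $S\{\ \}$): $ai{\downarrow}:\frac{S\{\mathsf t\}}{S[a,\bar a]}$, $ai{\uparrow}:\frac{S(a,\bar a)}{S\{\mathsf f\}}$, $s:\frac{S([R,U],T)}{S[(R,T),U]}$, $m:\frac{S[(R,U),(T,V)]}{S([R,T],[U,V])}$, $aw{\downarrow}:\frac{S\{\mathsf f\}}{S\{a\}}$, $aw{\uparrow}:\frac{S\{a\}}{S\{\mathsf t\}}$, $ac{\downarrow}:\frac{S[a,a]}{S\{a\}}$, $ac{\uparrow}:\frac{S\{a\}}{S(a,a)}$. -}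

module Defs where

open import Data.List.Base using (List; []; _∷_)
open import Data.List.NonEmpty.Base using (List⁺; _∷_; _++⁺_; _⁺++_)
open import Level using (0ℓ)
open import Relation.Unary using (Pred; _∈_; U)

private
  variable
    Var : Set

-- Atoms are propositional variables and negated propositional variables, so
-- negation is a fixed-point-free involution on atoms.
data Atom (Var : Set) : Set where
  pos neg : Var → Atom Var

_ᶜ : Atom Var → Atom Var
pos p ᶜ = neg p
neg p ᶜ = pos p

data Structure (Var : Set) : Set where
  𝖿 𝗍  : Structure Var
  atom : Atom Var → Structure Var
  dis  : List⁺ (Structure Var) → Structure Var
  con  : List⁺ (Structure Var) → Structure Var
  bar  : Structure Var → Structure Var

[_,_] : Structure Var → Structure Var → Structure Var
[ R , T ] = dis (R ∷ T ∷ [])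

⦅_,_⦆ : Structure Var → Structure Var → Structure Var
⦅ R , T ⦆ = con (R ∷ T ∷ [])

-- There is no clause for `bar`: the hole is never in the scope of a negation.
data Context (Var : Set) : Set where
  hole : Context Var
  dis  : List (Structure Var) → Context Var → List (Structure Var) → Context Var
  con  : List (Structure Var) → Context Var → List (Structure Var) → Context Var

infix 8 _⟪_⟫

_⟪_⟫ : Context Var → Structure Var → Structure Var
hole       ⟪ R ⟫ = R
dis Ts S Us ⟪ R ⟫ = dis (Ts ++⁺ (S ⟪ R ⟫ ∷ Us))
con Ts S Us ⟪ R ⟫ = con (Ts ++⁺ (S ⟪ R ⟫ ∷ Us))

infix 4 _≈_

data _≈_ {Var : Set} : Structure Var → Structure Var → Set where
  ≈-refl  : ∀ {R} → R ≈ R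
  ≈-sym   : ∀ {R T} → R ≈ T → T ≈ R
  ≈-trans : ∀ {R T V} → R ≈ T → T ≈ V → R ≈ V

  dis-assoc : ∀ Rs Ts Us → dis (Rs ++⁺ (dis Ts ∷ Us)) ≈ dis (Rs ++⁺ (Ts ⁺++ Us))
  con-assoc : ∀ Rs Ts Us → con (Rs ++⁺ (con Ts ∷ Us)) ≈ con (Rs ++⁺ (Ts ⁺++ Us))

  dis-comm : ∀ R T → [ R , T ] ≈ [ T , R ]
  con-comm : ∀ R T → ⦅ R , T ⦆ ≈ ⦅ T , R ⦆

  con-𝖿𝖿 : ⦅ 𝖿 , 𝖿 ⦆ ≈ 𝖿
  dis-𝖿  : ∀ R → [ 𝖿 , R ] ≈ R
  dis-𝗍𝗍 : [ 𝗍 , 𝗍 ] ≈ 𝗍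
  con-𝗍  : ∀ R → ⦅ 𝗍 , R ⦆ ≈ R

  bar-𝖿    : bar 𝖿 ≈ 𝗍
  bar-𝗍    : bar 𝗍 ≈ 𝖿
  bar-dis  : ∀ R T → bar [ R , T ] ≈ ⦅ bar R , bar T ⦆
  bar-con  : ∀ R T → bar ⦅ R , T ⦆ ≈ [ bar R , bar T ]
  bar-bar  : ∀ R → bar (bar R) ≈ R
  -- The negation of an atom is the dual atom.
  bar-atom : ∀ a → bar (atom a) ≈ atom (a ᶜ)

  ctx-cong : ∀ S {R T} → R ≈ T → S ⟪ R ⟫ ≈ S ⟪ T ⟫
  bar-cong : ∀ {R T} → R ≈ T → bar R ≈ bar T

data Rule : Set where
  ai↓ ai↑ s m aw↓ aw↑ ac↓ ac↑ : Rule

-- `Redex ρ P Q`: rule ρ has premise S{P} and conclusion S{Q}, for any context S{ }.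
data Redex {Var : Set} : Rule → Structure Var → Structure Var → Set where
  ai↓ : ∀ a → Redex ai↓ 𝗍 [ atom a , bar (atom a) ]
  ai↑ : ∀ a → Redex ai↑ ⦅ atom a , bar (atom a) ⦆ 𝖿
  s   : ∀ R T U → Redex s ⦅ [ R , U ] , T ⦆ [ ⦅ R , T ⦆ , U ]
  m   : ∀ R T U V →
        Redex m [ ⦅ R , U ⦆ , ⦅ T , V ⦆ ] ⦅ [ R , T ] , [ U , V ] ⦆
  aw↓ : ∀ a → Redex aw↓ 𝖿 (atom a)
  aw↑ : ∀ a → Redex aw↑ (atom a) 𝗍
  ac↓ : ∀ a → Redex ac↓ [ atom a , atom a ] (atom a)
  ac↑ : ∀ a → Redex ac↑ (atom a) ⦅ atom a , atom a ⦆

System : Set₁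
System = Pred Rule 0ℓ

SKS : System
SKS = U

-- Equivalent structures are not distinguished, so premises, conclusions and
-- one-structure derivations are all taken up to _≈_.
data Instance {Var : Set} (𝒮 : System) (P Q : Structure Var) : Set where
  inst : ∀ {ρ} → ρ ∈ 𝒮 → ∀ S {P′ Q′} → Redex ρ P′ Q′ →
         P ≈ S ⟪ P′ ⟫ → S ⟪ Q′ ⟫ ≈ Q → Instance 𝒮 P Q

data Derivation {Var : Set} (𝒮 : System) : (premise conclusion : Structure Var) → Set where
  single : ∀ {T R} → T ≈ R → Derivation 𝒮 T R
  _then_ : ∀ {T Q R} → Instance 𝒮 T Q → Derivation 𝒮 Q R → Derivation 𝒮 T R

{-# OPTIONS --safe #-}
module Submission where

-- A derivation from T to R makes [T̄,R] classically valid, so each clause of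
-- its conjunctive normal form contains a dual pair of atoms. Running the
-- normal form backwards, as in a cut-free sequent proof, gives a
-- contraction-free derivation from 𝗍 to some [X,Y] that reaches [T̄,R] by ac↓
-- alone: a contraction is either an ac↓ at the very bottom or an instance of
-- medial. Dualising the ac↓ steps from X to T̄ gives ac↑ steps from T to
-- V = X̄, and switch and the cut (X̄,X) → 𝖿 lead from V = (V,𝗍) through
-- (V,[X,Y]) to U = Y, which contracts to R.

open import Data.List.Base using (List; []; _∷_; _++_)
open import Data.List.NonEmpty.Base using (_∷_; _++⁺_; _⁺++_; toList)
open import Data.List.Properties using (++-identityʳ)
open import Data.Product using (_×_; _,_; proj₁; proj₂; ∃-syntax)
open import Data.Sum using (inj₁; inj₂)
open import Data.Unit using (⊤; tt)
open import Function using (id; _∘_)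
open import Level using (0ℓ)
open import Relation.Binary.Bundles using (Preorder)
open import Relation.Binary.PropositionalEquality using (_≡_; _≢_; refl; cong)
open import Relation.Binary.Structures using (IsEquivalence)
import Relation.Binary.Reasoning.Preorder as PreorderReasoning
open import Relation.Unary using (｛_｝; _∪_; _∖_; _∈_)
open import Defs

private
  variable
    Var : Set
    𝒮 : System
    P Q X Y Z : Structure Var

-- Equivalence of structures and composition of derivations

≈-isEquivalence : IsEquivalence (_≈_ {Var})
≈-isEquivalence = record { refl = ≈-refl ; sym = ≈-sym ; trans = ≈-trans }

≈-reflexive : P ≡ Q → P ≈ Q
≈-reflexive = IsEquivalence.reflexive ≈-isEquivalence

dis-cong : P ≈ Q → X ≈ Y → [ P , X ] ≈ [ Q , Y ]
dis-cong p x =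
  ≈-trans (ctx-cong (dis [] hole (_ ∷ [])) p) (ctx-cong (dis (_ ∷ []) hole []) x)

con-cong : P ≈ Q → X ≈ Y → ⦅ P , X ⦆ ≈ ⦅ Q , Y ⦆
con-cong p x =
  ≈-trans (ctx-cong (con [] hole (_ ∷ [])) p) (ctx-cong (con (_ ∷ []) hole []) x)

dis-cons : ∀ (X Y : Structure Var) Xs → [ X , dis (Y ∷ Xs) ] ≈ dis (X ∷ Y ∷ Xs)
dis-cons X Y Xs =
  ≈-trans (dis-assoc (X ∷ []) (Y ∷ Xs) [])
          (≈-reflexive (cong (λ Zs → dis (X ∷ Y ∷ Zs)) (++-identityʳ Xs)))

con-cons : ∀ (X Y : Structure Var) Xs → ⦅ X , con (Y ∷ Xs) ⦆ ≈ con (X ∷ Y ∷ Xs)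
con-cons X Y Xs =
  ≈-trans (con-assoc (X ∷ []) (Y ∷ Xs) [])
          (≈-reflexive (cong (λ Zs → con (X ∷ Y ∷ Zs)) (++-identityʳ Xs)))

dis-assoc₂ : [ [ X , Y ] , Z ] ≈ [ X , [ Y , Z ] ]
dis-assoc₂ = ≈-trans (dis-assoc [] (_ ∷ _ ∷ []) (_ ∷ [])) (≈-sym (dis-cons _ _ _))

con-assoc₂ : ⦅ ⦅ X , Y ⦆ , Z ⦆ ≈ ⦅ X , ⦅ Y , Z ⦆ ⦆
con-assoc₂ = ≈-trans (con-assoc [] (_ ∷ _ ∷ []) (_ ∷ [])) (≈-sym (con-cons _ _ _))

dis-swap : [ X , [ Y , Z ] ] ≈ [ Y , [ X , Z ] ]
dis-swap =
  ≈-trans (≈-sym dis-assoc₂) (≈-trans (dis-cong (dis-comm _ _) ≈-refl) dis-assoc₂)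

dis-identityʳ : [ X , 𝖿 ] ≈ X
dis-identityʳ = ≈-trans (dis-comm _ _) (dis-𝖿 _)

con-identityʳ : ⦅ X , 𝗍 ⦆ ≈ X
con-identityʳ = ≈-trans (con-comm _ _) (con-𝗍 _)

-- Padding with the unit makes the singleton an inner list, which associativity flattens.
dis-singleton : ∀ (X : Structure Var) → dis (X ∷ []) ≈ X
dis-singleton X =
  ≈-trans (≈-sym (dis-𝖿 _)) (≈-trans (dis-assoc (𝖿 ∷ []) (X ∷ []) []) (dis-𝖿 _))

con-singleton : ∀ (X : Structure Var) → con (X ∷ []) ≈ X
con-singleton X =
  ≈-trans (≈-sym (con-𝗍 _)) (≈-trans (con-assoc (𝗍 ∷ []) (X ∷ []) []) (con-𝗍 _))

infixr 5 _⨟_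

_⨟_ : Derivation 𝒮 X Y → Derivation 𝒮 Y Z → Derivation 𝒮 X Z
single p ⨟ single q = single (≈-trans p q)
single p ⨟ (inst ρ∈𝒮 S redex q r then d) = inst ρ∈𝒮 S redex (≈-trans p q) r then d
(i then d) ⨟ d′ = i then (d ⨟ d′)

derivation-preorder : Set → System → Preorder 0ℓ 0ℓ 0ℓ
derivation-preorder Var 𝒮 = record
  { Carrier    = Structure Var
  ; _≈_        = _≈_
  ; _≲_        = Derivation 𝒮
  ; isPreorder = record
    { isEquivalence = ≈-isEquivalence ; reflexive = single ; trans = _⨟_ }
  }

module D-Reasoning {Var : Set} {𝒮 : System} = PreorderReasoning (derivation-preorder Var 𝒮)

rule : ∀ {ρ} → ρ ∈ 𝒮 → Redex ρ P Q → Derivation 𝒮 P Q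
rule ρ∈𝒮 redex = inst ρ∈𝒮 hole redex ≈-refl ≈-refl then single ≈-refl

-- Deep inference: each rule instance stays an instance of the same rule when its context gains one
-- more layer.
dis-ctx : ∀ Ts Us → Derivation 𝒮 P Q →
          Derivation 𝒮 (dis (Ts ++⁺ (P ∷ Us))) (dis (Ts ++⁺ (Q ∷ Us)))
dis-ctx Ts Us (single p) = single (ctx-cong (dis Ts hole Us) p)
dis-ctx Ts Us (inst ρ∈𝒮 S redex p q then d) =
  inst ρ∈𝒮 (dis Ts S Us) redex (ctx-cong (dis Ts hole Us) p) (ctx-cong (dis Ts hole Us) q)
  then dis-ctx Ts Us d

con-ctx : ∀ Ts Us → Derivation 𝒮 P Q →
          Derivation 𝒮 (con (Ts ++⁺ (P ∷ Us))) (con (Ts ++⁺ (Q ∷ Us)))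
con-ctx Ts Us (single p) = single (ctx-cong (con Ts hole Us) p)
con-ctx Ts Us (inst ρ∈𝒮 S redex p q then d) =
  inst ρ∈𝒮 (con Ts S Us) redex (ctx-cong (con Ts hole Us) p) (ctx-cong (con Ts hole Us) q)
  then con-ctx Ts Us d

dis-mono : Derivation 𝒮 P Q → Derivation 𝒮 X Y → Derivation 𝒮 [ P , X ] [ Q , Y ]
dis-mono d e = dis-ctx [] (_ ∷ []) d ⨟ dis-ctx (_ ∷ []) [] e

con-mono : Derivation 𝒮 P Q → Derivation 𝒮 X Y → Derivation 𝒮 ⦅ P , X ⦆ ⦅ Q , Y ⦆
con-mono d e = con-ctx [] (_ ∷ []) d ⨟ con-ctx (_ ∷ []) [] e

-- Contraction-free derivations

NC : System
NC = SKS ∖ (｛ ac↓ ｝ ∪ ｛ ac↑ ｝)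

rule-NC : ∀ {ρ} → ac↓ ≢ ρ → ac↑ ≢ ρ → Redex ρ P Q → Derivation NC P Q
rule-NC ≢ac↓ ≢ac↑ = rule (tt , λ { (inj₁ eq) → ≢ac↓ eq ; (inj₂ eq) → ≢ac↑ eq })

switch : Derivation NC ⦅ [ P , Q ] , X ⦆ [ ⦅ P , X ⦆ , Q ]
switch = rule-NC (λ ()) (λ ()) (s _ _ _)

medial : Derivation NC [ ⦅ P , Q ⦆ , ⦅ X , Y ⦆ ] ⦅ [ P , X ] , [ Q , Y ] ⦆
medial = rule-NC (λ ()) (λ ()) (m _ _ _ _)

switch₂ : Derivation NC ⦅ [ P , X ] , [ Q , Y ] ⦆ [ ⦅ P , Q ⦆ , [ X , Y ] ]
switch₂ {P = P} {X} {Q} {Y} = begin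
  ⦅ [ P , X ] , [ Q , Y ] ⦆   ≲⟨ switch ⟩
  [ ⦅ P , [ Q , Y ] ⦆ , X ]   ≈⟨ dis-cong (con-comm _ _) ≈-refl ⟩
  [ ⦅ [ Q , Y ] , P ⦆ , X ]   ≲⟨ dis-mono switch (single ≈-refl) ⟩
  [ [ ⦅ Q , P ⦆ , Y ] , X ]   ≈⟨ dis-assoc₂ ⟩
  [ ⦅ Q , P ⦆ , [ Y , X ] ]   ≈⟨ dis-cong (con-comm _ _) (dis-comm _ _) ⟩
  [ ⦅ P , Q ⦆ , [ X , Y ] ]   ∎
  where open D-Reasoning

-- Two switches send each conjunct to its own disjunct. This reduces a cut on a compound formula to
-- cuts on its two parts.
con-dis-pair : Derivation NC ⦅ ⦅ P , Q ⦆ , [ X , Y ] ⦆ [ ⦅ P , X ⦆ , ⦅ Q , Y ⦆ ]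
con-dis-pair {P = P} {Q} {X} {Y} = begin
  ⦅ ⦅ P , Q ⦆ , [ X , Y ] ⦆     ≈⟨ con-cong (con-comm _ _) ≈-refl ⟩
  ⦅ ⦅ Q , P ⦆ , [ X , Y ] ⦆     ≈⟨ con-assoc₂ ⟩
  ⦅ Q , ⦅ P , [ X , Y ] ⦆ ⦆     ≈⟨ con-cong ≈-refl (con-comm _ _) ⟩
  ⦅ Q , ⦅ [ X , Y ] , P ⦆ ⦆     ≲⟨ con-mono (single ≈-refl) switch ⟩
  ⦅ Q , [ ⦅ X , P ⦆ , Y ] ⦆     ≈⟨ con-cong ≈-refl (dis-comm _ _) ⟩
  ⦅ Q , [ Y , ⦅ X , P ⦆ ] ⦆     ≈⟨ con-comm _ _ ⟩
  ⦅ [ Y , ⦅ X , P ⦆ ] , Q ⦆     ≲⟨ switch ⟩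
  [ ⦅ Y , Q ⦆ , ⦅ X , P ⦆ ]     ≈⟨ dis-comm _ _ ⟩
  [ ⦅ X , P ⦆ , ⦅ Y , Q ⦆ ]     ≈⟨ dis-cong (con-comm _ _) (con-comm _ _) ⟩
  [ ⦅ P , X ⦆ , ⦅ Q , Y ⦆ ]     ∎
  where open D-Reasoning

-- Negation normal forms

infixr 6 _∧_
infixr 5 _∨_

data Formula (Var : Set) : Set where
  𝖿 𝗍     : Formula Var
  atom    : Atom Var → Formula Var
  _∨_ _∧_ : Formula Var → Formula Var → Formula Var

private
  variable
    a : Atom Var
    A A′ B C D : Formula Var

⌜_⌝ : Formula Var → Structure Var
⌜ 𝖿 ⌝      = 𝖿
⌜ 𝗍 ⌝      = 𝗍
⌜ atom a ⌝ = atom a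
⌜ A ∨ B ⌝  = [ ⌜ A ⌝ , ⌜ B ⌝ ]
⌜ A ∧ B ⌝  = ⦅ ⌜ A ⌝ , ⌜ B ⌝ ⦆

dual : Formula Var → Formula Var
dual 𝖿        = 𝗍
dual 𝗍        = 𝖿
dual (atom a) = atom (a ᶜ)
dual (A ∨ B)  = dual A ∧ dual B
dual (A ∧ B)  = dual A ∨ dual B

⌜dual⌝ : ∀ (A : Formula Var) → bar ⌜ A ⌝ ≈ ⌜ dual A ⌝
⌜dual⌝ 𝖿        = bar-𝖿
⌜dual⌝ 𝗍        = bar-𝗍
⌜dual⌝ (atom a) = bar-atom a
⌜dual⌝ (A ∨ B)  = ≈-trans (bar-dis _ _) (con-cong (⌜dual⌝ A) (⌜dual⌝ B))
⌜dual⌝ (A ∧ B)  = ≈-trans (bar-con _ _) (dis-cong (⌜dual⌝ A) (⌜dual⌝ B))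

mutual
  nnf : Structure Var → Formula Var
  nnf 𝖿              = 𝖿
  nnf 𝗍              = 𝗍
  nnf (atom a)       = atom a
  nnf (dis (R ∷ Rs)) = nnf-dis R Rs
  nnf (con (R ∷ Rs)) = nnf-con R Rs
  nnf (bar R)        = dual (nnf R)

  nnf-dis nnf-con : Structure Var → List (Structure Var) → Formula Var
  nnf-dis R []       = nnf R
  nnf-dis R (T ∷ Ts) = nnf R ∨ nnf-dis T Ts
  nnf-con R []       = nnf R
  nnf-con R (T ∷ Ts) = nnf R ∧ nnf-con T Ts

mutual
  nnf-≈ : ∀ (R : Structure Var) → R ≈ ⌜ nnf R ⌝
  nnf-≈ 𝖿              = ≈-refl
  nnf-≈ 𝗍              = ≈-refl
  nnf-≈ (atom a)       = ≈-refl
  nnf-≈ (dis (R ∷ Rs)) = nnf-dis-≈ R Rs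
  nnf-≈ (con (R ∷ Rs)) = nnf-con-≈ R Rs
  nnf-≈ (bar R)        = ≈-trans (bar-cong (nnf-≈ R)) (⌜dual⌝ (nnf R))

  nnf-dis-≈ : ∀ (R : Structure Var) Rs → dis (R ∷ Rs) ≈ ⌜ nnf-dis R Rs ⌝
  nnf-dis-≈ R []       = ≈-trans (dis-singleton R) (nnf-≈ R)
  nnf-dis-≈ R (T ∷ Ts) =
    ≈-trans (≈-sym (dis-cons R T Ts)) (dis-cong (nnf-≈ R) (nnf-dis-≈ T Ts))

  nnf-con-≈ : ∀ (R : Structure Var) Rs → con (R ∷ Rs) ≈ ⌜ nnf-con R Rs ⌝
  nnf-con-≈ R []       = ≈-trans (con-singleton R) (nnf-≈ R)
  nnf-con-≈ R (T ∷ Ts) =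
    ≈-trans (≈-sym (con-cons R T Ts)) (con-cong (nnf-≈ R) (nnf-con-≈ T Ts))

interaction↑ : ∀ (A : Formula Var) → Derivation NC ⦅ ⌜ dual A ⌝ , ⌜ A ⌝ ⦆ 𝖿
interaction↑ 𝖿 = single (con-𝗍 _)
interaction↑ 𝗍 = single con-identityʳ
interaction↑ (atom a) =
  single (≈-trans (con-comm _ _) (con-cong ≈-refl (≈-sym (bar-atom a))))
  ⨟ rule-NC (λ ()) (λ ()) (ai↑ a)
interaction↑ (A ∨ B) =
  con-dis-pair ⨟ dis-mono (interaction↑ A) (interaction↑ B) ⨟ single (dis-𝖿 _)
interaction↑ (A ∧ B) =
  single (con-comm _ _) ⨟ con-dis-pair
  ⨟ dis-mono (single (con-comm _ _) ⨟ interaction↑ A) (single (con-comm _ _) ⨟ interaction↑ B)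
  ⨟ single (dis-𝖿 _)

weakening↓ : ∀ (A : Formula Var) → Derivation NC 𝖿 ⌜ A ⌝
weakening↓ 𝖿 = single ≈-refl
-- `aw↓` introduces only atoms; `𝗍` comes from a switch between units, after `𝗍` is doubled to
-- `[ 𝗍 , 𝗍 ]`.
weakening↓ 𝗍 = begin
  𝖿                   ≈⟨ con-𝗍 _ ⟨
  ⦅ 𝗍 , 𝖿 ⦆           ≈⟨ con-cong dis-𝗍𝗍 ≈-refl ⟨
  ⦅ [ 𝗍 , 𝗍 ] , 𝖿 ⦆   ≲⟨ switch ⟩
  [ ⦅ 𝗍 , 𝖿 ⦆ , 𝗍 ]   ≈⟨ dis-cong (con-𝗍 _) ≈-refl ⟩
  [ 𝖿 , 𝗍 ]           ≈⟨ dis-𝖿 _ ⟩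
  𝗍                   ∎
  where open D-Reasoning
weakening↓ (atom a) = rule-NC (λ ()) (λ ()) (aw↓ a)
weakening↓ (A ∨ B) = single (≈-sym (dis-𝖿 _)) ⨟ dis-mono (weakening↓ A) (weakening↓ B)
weakening↓ (A ∧ B) = single (≈-sym con-𝖿𝖿) ⨟ con-mono (weakening↓ A) (weakening↓ B)

-- Expansions

infix 4 _▷_ _⟿_ _∈ₐ_

-- Atoms of the right-hand formula become trees of copies of themselves on the left. As only atoms
-- are split, its connectives remain visible in every expansion, which can therefore be analysed by
-- matching.
data _▷_ {Var : Set} : Formula Var → Formula Var → Set where
  𝖿     : 𝖿 ▷ 𝖿
  𝗍     : 𝗍 ▷ 𝗍
  atom  : ∀ {a} → atom a ▷ atom a
  split : ∀ {A B a} → A ▷ atom a → B ▷ atom a → A ∨ B ▷ atom a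
  _∨_   : ∀ {A A′ B B′} → A′ ▷ A → B′ ▷ B → A′ ∨ B′ ▷ A ∨ B
  _∧_   : ∀ {A A′ B B′} → A′ ▷ A → B′ ▷ B → A′ ∧ B′ ▷ A ∧ B

▷-refl : ∀ (A : Formula Var) → A ▷ A
▷-refl 𝖿        = 𝖿
▷-refl 𝗍        = 𝗍
▷-refl (atom a) = atom
▷-refl (A ∨ B)  = ▷-refl A ∨ ▷-refl B
▷-refl (A ∧ B)  = ▷-refl A ∧ ▷-refl B

contraction↓ : A′ ▷ A → Derivation ｛ ac↓ ｝ ⌜ A′ ⌝ ⌜ A ⌝
contraction↓ 𝖿           = single ≈-refl
contraction↓ 𝗍           = single ≈-refl
contraction↓ atom        = single ≈-refl
contraction↓ (split x y) =
  dis-mono (contraction↓ x) (contraction↓ y) ⨟ rule refl (ac↓ _)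
contraction↓ (x ∨ y)     = dis-mono (contraction↓ x) (contraction↓ y)
contraction↓ (x ∧ y)     = con-mono (contraction↓ x) (contraction↓ y)

-- Duality turns each contraction of an atom into a cocontraction of the dual atom, so one relation
-- serves both the top and the bottom phase.
contraction↑ : A′ ▷ A → Derivation ｛ ac↑ ｝ ⌜ dual A ⌝ ⌜ dual A′ ⌝
contraction↑ 𝖿           = single ≈-refl
contraction↑ 𝗍           = single ≈-refl
contraction↑ atom        = single ≈-refl
contraction↑ (split x y) =
  rule refl (ac↑ _) ⨟ con-mono (contraction↑ x) (contraction↑ y)
contraction↑ (x ∨ y)     = con-mono (contraction↑ x) (contraction↑ y)
contraction↑ (x ∧ y)     = dis-mono (contraction↑ x) (contraction↑ y)

-- Derivability with contraction postponed: this relation composes, and `merge`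
-- below makes full contraction available in it.
_⟿_ : Formula Var → Formula Var → Set
A ⟿ B = ∀ {A′} → A′ ▷ A → ∃[ B′ ] (B′ ▷ B × Derivation NC ⌜ A′ ⌝ ⌜ B′ ⌝)

infixr 4 _⟫_

_⟫_ : A ⟿ B → B ⟿ C → A ⟿ C
(f ⟫ g) x =
  let _ , y , d = f x
      _ , z , e = g y
  in _ , z , d ⨟ e

⟿-refl : A ⟿ A
⟿-refl x = _ , x , single ≈-refl

∨-mono : A ⟿ B → C ⟿ D → A ∨ C ⟿ B ∨ D
∨-mono f g (x ∨ y) =
  let _ , x′ , d = f x
      _ , y′ , e = g y
  in _ , x′ ∨ y′ , dis-mono d e

∧-mono : A ⟿ B → C ⟿ D → A ∧ C ⟿ B ∧ D
∧-mono f g (x ∧ y) =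
  let _ , x′ , d = f x
      _ , y′ , e = g y
  in _ , x′ ∧ y′ , con-mono d e

∨-comm : A ∨ B ⟿ B ∨ A
∨-comm (x ∨ y) = _ , y ∨ x , single (dis-comm _ _)

∨-assocˡ : A ∨ B ∨ C ⟿ (A ∨ B) ∨ C
∨-assocˡ (x ∨ y ∨ z) = _ , (x ∨ y) ∨ z , single (≈-sym dis-assoc₂)

∨-assocʳ : (A ∨ B) ∨ C ⟿ A ∨ B ∨ C
∨-assocʳ ((x ∨ y) ∨ z) = _ , x ∨ y ∨ z , single dis-assoc₂

∨-swap : A ∨ B ∨ C ⟿ B ∨ A ∨ C
∨-swap (x ∨ y ∨ z) = _ , y ∨ x ∨ z ,
  single dis-swap

∨-identityʳ : A ∨ 𝖿 ⟿ A
∨-identityʳ (x ∨ 𝖿) = _ , x , single dis-identityʳ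

∨-identityʳ⁻¹ : A ⟿ A ∨ 𝖿
∨-identityʳ⁻¹ x = _ , x ∨ 𝖿 , single (≈-sym dis-identityʳ)

𝗍⟿𝗍∧𝗍 : 𝗍 ⟿ 𝗍 ∧ (𝗍 {Var})
𝗍⟿𝗍∧𝗍 𝗍 = _ , 𝗍 ∧ 𝗍 , single (≈-sym (con-𝗍 _))

∧-∨-switch : (A ∨ C) ∧ (B ∨ D) ⟿ (A ∧ B) ∨ C ∨ D
∧-∨-switch ((x ∨ z) ∧ (y ∨ w)) = _ , (x ∧ y) ∨ z ∨ w , switch₂

𝖿⟿ : ∀ (A : Formula Var) → 𝖿 ⟿ A
𝖿⟿ A 𝖿 = _ , ▷-refl A , weakening↓ A

-- The two disjuncts may be different expansions of `A`, so the recursion descends through both in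
-- parallel.
merge : A ∨ A ⟿ A
merge (𝖿 ∨ 𝖿) = _ , 𝖿 , single (dis-𝖿 _)
merge (𝗍 ∨ 𝗍) = _ , 𝗍 , single dis-𝗍𝗍
-- The contraction is not performed here but recorded by `split`, which postpones it.
merge {A = atom a} (x ∨ y) = _ , split x y , single ≈-refl
merge ((x ∨ y) ∨ (x′ ∨ y′)) =
  let _ , x″ , d = merge (x ∨ x′)
      _ , y″ , e = merge (y ∨ y′)
  in _ , x″ ∨ y″ ,
     single (≈-trans dis-assoc₂ (≈-trans (dis-cong ≈-refl dis-swap) (≈-sym dis-assoc₂)))
     ⨟ dis-mono d e
merge ((x ∧ y) ∨ (x′ ∧ y′)) =
  let _ , x″ , d = merge (x ∨ x′)
      _ , y″ , e = merge (y ∨ y′)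
  -- Medial pairs corresponding conjuncts of the two copies, so that each pair merges separately.
  in _ , x″ ∧ y″ , medial ⨟ con-mono d e

interaction↓ : ∀ (p : Var) → 𝗍 ⟿ atom (pos p) ∨ atom (neg p)
interaction↓ p 𝗍 = _ , atom ∨ atom ,
  rule-NC (λ ()) (λ ()) (ai↓ (pos p)) ⨟ single (dis-cong ≈-refl (bar-atom _))

-- Clauses and dual pairs of atoms

data Clause {Var : Set} : Formula Var → Set where
  𝖿    : Clause 𝖿
  atom : ∀ a → Clause (atom a)
  _∨_  : Clause A → Clause B → Clause (A ∨ B)

data _∈ₐ_ {Var : Set} (a : Atom Var) : Formula Var → Set where
  here  : a ∈ₐ atom a
  left  : a ∈ₐ A → a ∈ₐ A ∨ B
  right : a ∈ₐ B → a ∈ₐ A ∨ B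

∈ₐ-⟿ : a ∈ₐ A → atom a ⟿ A
∈ₐ-⟿ here      = ⟿-refl
∈ₐ-⟿ (left i)  = ∨-identityʳ⁻¹ ⟫ ∨-mono (∈ₐ-⟿ i) (𝖿⟿ _)
∈ₐ-⟿ (right i) = ∨-identityʳ⁻¹ ⟫ ∨-comm ⟫ ∨-mono (𝖿⟿ _) (∈ₐ-⟿ i)

Clash : Formula Var → Set
Clash A = ∃[ p ] (pos p ∈ₐ A × neg p ∈ₐ A)

-- Each atom of a freshly introduced dual pair is weakened to a full copy of `A`, and the two copies
-- are merged.
clash-⟿ : Clash A → 𝗍 ⟿ A
clash-⟿ (p , i , j) = interaction↓ p ⟫ ∨-mono (∈ₐ-⟿ i) (∈ₐ-⟿ j) ⟫ merge

-- Classical truth values are the sets stable under double negation relative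
-- to an arbitrary answer type; this makes completeness constructive even
-- though equality of variables need not be decidable.
module Semantics {Var : Set} (Answer : Set) (v : Var → Set) where

  infix 8 ~_

  ~_ : Set → Set
  ~ X = X → Answer

  mutual
    -- `Answer` stands for falsity. Atoms, disjunctions and `bar` are read as negations, hence are
    -- stable whatever set `v p` is.
    ⟦_⟧ : Structure Var → Set
    ⟦ 𝖿 ⟧            = Answer
    ⟦ 𝗍 ⟧            = ⊤
    ⟦ atom (pos p) ⟧ = ~ v p
    ⟦ atom (neg p) ⟧ = ~ ~ v p
    ⟦ dis (R ∷ Rs) ⟧ = ~ (~ ⟦ R ⟧ × Every ~_ Rs)
    ⟦ con (R ∷ Rs) ⟧ = ⟦ R ⟧ × Every id Rs
    ⟦ bar R ⟧        = ~ ⟦ R ⟧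

    Every : (Set → Set) → List (Structure Var) → Set
    Every F []       = ⊤
    Every F (R ∷ Rs) = F ⟦ R ⟧ × Every F Rs

  mutual
    stable : ∀ R → ~ ~ ⟦ R ⟧ → ⟦ R ⟧
    stable 𝖿 k              = k id
    stable 𝗍 k              = tt
    stable (atom (pos p)) k = λ x → k λ f → f x
    stable (atom (neg p)) k = λ x → k λ f → f x
    stable (dis (R ∷ Rs)) k = λ x → k λ f → f x
    stable (con (R ∷ Rs)) k =
      stable R (λ f → k (f ∘ proj₁)) , every-stable Rs (λ f → k (f ∘ proj₂))
    stable (bar R) k        = λ x → k λ f → f x

    every-stable : ∀ Rs → ~ ~ Every id Rs → Every id Rs
    every-stable [] k       = tt
    every-stable (R ∷ Rs) k =
      stable R (λ f → k (f ∘ proj₁)) , every-stable Rs (λ f → k (f ∘ proj₂))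

  every~-stable : ∀ Rs → ~ ~ Every ~_ Rs → Every ~_ Rs
  every~-stable [] k       = tt
  every~-stable (R ∷ Rs) k =
    (λ x → k λ f → proj₁ f x) , every~-stable Rs (λ f → k (f ∘ proj₂))

  exfalso : ∀ R → Answer → ⟦ R ⟧
  exfalso R x = stable R λ _ → x

  module _ {F : Set → Set} where

    every-++ : ∀ Rs {Ts} → Every F Rs × Every F Ts → Every F (Rs ++ Ts)
    every-++ []       (_ , ts)        = ts
    every-++ (R ∷ Rs) ((r , rs) , ts) = r , every-++ Rs (rs , ts)

    every-++⁻ : ∀ Rs {Ts} → Every F (Rs ++ Ts) → Every F Rs × Every F Ts
    every-++⁻ []       ts       = tt , ts
    every-++⁻ (R ∷ Rs) (r , ts) = let rs , ts′ = every-++⁻ Rs ts in (r , rs) , ts′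

    every-++⁺-map : ∀ Rs {Ts Us} → (Every F (toList Ts) → Every F (toList Us)) →
                    Every F (toList (Rs ++⁺ Ts)) → Every F (toList (Rs ++⁺ Us))
    every-++⁺-map []       f x       = f x
    every-++⁺-map (R ∷ Rs) f (r , x) = r , every-++⁺-map Rs f x

  -- Serves disjunctions with `F = ~_` and conjunctions with `F = id`.
  every-flatten : ∀ F H Rs Ts Us → (F ⟦ H ⟧ → Every F (toList Ts)) →
                  Every F (toList (Rs ++⁺ (H ∷ Us))) → Every F (toList (Rs ++⁺ (Ts ⁺++ Us)))
  every-flatten F H Rs Ts Us f =
    every-++⁺-map Rs λ (h , us) → every-++ (toList Ts) (f h , us)

  every-unflatten : ∀ F H Rs Ts Us → (Every F (toList Ts) → F ⟦ H ⟧) →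
                    Every F (toList (Rs ++⁺ (Ts ⁺++ Us))) → Every F (toList (Rs ++⁺ (H ∷ Us)))
  every-unflatten F H Rs Ts Us f =
    every-++⁺-map Rs λ x → let ts , us = every-++⁻ (toList Ts) x in f ts , us

  ctx-mono : ∀ S {P Q} → (⟦ P ⟧ → ⟦ Q ⟧) → ⟦ S ⟪ P ⟫ ⟧ → ⟦ S ⟪ Q ⟫ ⟧
  ctx-mono hole          f = f
  ctx-mono (con Ts S Us) f = every-++⁺-map Ts λ (x , us) → ctx-mono S f x , us
  ctx-mono (dis Ts S Us) f k x =
    k (every-++⁺-map Ts (λ (y , us) → y ∘ ctx-mono S f , us) x)

  -- Both directions are proved together because `≈-sym` exchanges them and `bar-cong` reverses
  -- them.
  ≈-sound : ∀ {P Q} → P ≈ Q → (⟦ P ⟧ → ⟦ Q ⟧) × (⟦ Q ⟧ → ⟦ P ⟧)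
  ≈-sound ≈-refl = id , id
  ≈-sound (≈-sym p) = let f , g = ≈-sound p in g , f
  ≈-sound (≈-trans p q) =
    let f , g = ≈-sound p
        h , k = ≈-sound q
    in h ∘ f , g ∘ k
  ≈-sound (dis-assoc Rs Ts Us) =
      (_∘ every-unflatten ~_ (dis Ts) Rs Ts Us (λ ts k → k ts))
    , (_∘ every-flatten ~_ (dis Ts) Rs Ts Us (every~-stable (toList Ts)))
  ≈-sound (con-assoc Rs Ts Us) =
      every-flatten id (con Ts) Rs Ts Us id
    , every-unflatten id (con Ts) Rs Ts Us id
  ≈-sound (dis-comm R T) =
      (λ { k (t , r , _) → k (r , t , _) })
    , (λ { k (r , t , _) → k (t , r , _) })
  ≈-sound (con-comm R T) =
      (λ { (r , t , _) → t , r , _ })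
    , (λ { (t , r , _) → r , t , _ })
  ≈-sound con-𝖿𝖿 = proj₁ , (λ x → x , x , _)
  ≈-sound (dis-𝖿 R) = (λ k → stable R λ r → k (id , r , _)) , (λ { r (_ , k , _) → k r })
  ≈-sound dis-𝗍𝗍 = (λ _ → tt) , (λ { _ (k , _) → k tt })
  ≈-sound (con-𝗍 R) = (λ { (_ , r , _) → r }) , (λ r → _ , r , _)
  ≈-sound bar-𝖿 = (λ _ → tt) , (λ _ → id)
  ≈-sound bar-𝗍 = (λ k → k tt) , (λ x _ → x)
  ≈-sound (bar-dis R T) =
      (λ k → (λ r → k λ f → proj₁ f r) , (λ t → k λ f → proj₁ (proj₂ f) t) , _)
    , (λ x k → k x)
  ≈-sound (bar-con R T) =
      (λ { k (r , t , _) → r λ x → t λ y → k (x , y , _) })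
    , (λ { k (r , t , _) → k ((λ f → f r) , (λ f → f t) , _) })
  ≈-sound (bar-bar R) = stable R , (λ r k → k r)
  ≈-sound (bar-atom (pos p)) = id , id
  ≈-sound (bar-atom (neg p)) = (λ k x → k λ f → f x) , (λ f k → k f)
  ≈-sound (ctx-cong S p) =
    let f , g = ≈-sound p in ctx-mono S f , ctx-mono S g
  ≈-sound (bar-cong p) =
    let f , g = ≈-sound p in (_∘ g) , (_∘ f)

  redex-sound : ∀ {ρ P Q} → Redex ρ P Q → ⟦ P ⟧ → ⟦ Q ⟧
  redex-sound (ai↓ a) _ (k , l , _) = l k
  redex-sound (ai↑ a) (x , k , _) = k x
  redex-sound (s R T U) (k , t , _) (l , u , _) = k ((λ r → l (r , t , _)) , u , _)
  redex-sound (m R T U V) k =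
      (λ { (r , t , _) → k (r ∘ proj₁ , t ∘ proj₁ , _) })
    , (λ { (u , v , _) → k (u ∘ proj₁ ∘ proj₂ , v ∘ proj₁ ∘ proj₂ , _) })
    , _
  redex-sound (aw↓ a) = exfalso (atom a)
  redex-sound (aw↑ a) _ = tt
  redex-sound (ac↓ a) k = stable (atom a) λ x → k (x , x , _)
  redex-sound (ac↑ a) x = x , x , _

  sound : ∀ {P Q} → Derivation 𝒮 P Q → ⟦ P ⟧ → ⟦ Q ⟧
  sound (single p) = proj₁ (≈-sound p)
  sound (inst _ S redex p q then d) =
    sound d ∘ proj₁ (≈-sound q) ∘ ctx-mono S (redex-sound redex) ∘ proj₁ (≈-sound p)

-- Completeness for postponed contraction

open Semantics using (⟦_⟧; ≈-sound; sound)

_⊨_ : Structure Var → Structure Var → Set₁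
P ⊨ Q = ∀ Answer v → ⟦_⟧ Answer v P → ⟦_⟧ Answer v Q

-- With `Clash C` itself as the answer type, refuting `C` means exhibiting a dual pair, so variables
-- are never compared.
valid-clause-clash : Clause C → 𝗍 ⊨ ⌜ C ⌝ → Clash C
valid-clause-clash {C = C} clause valid = refute clause id (valid _ _ tt)
  where
  -- This valuation makes every atom of C false.
  refute : Clause D → (∀ {a} → a ∈ₐ D → a ∈ₐ C) →
           ⟦_⟧ (Clash C) (λ p → pos p ∈ₐ C) ⌜ D ⌝ → Clash C
  refute 𝖿              _ x = x
  refute (atom (pos p)) i x = x (i here)
  -- The pair appears here: `j` locates `pos p` in `C`, and `i here` locates `neg p`.
  refute (atom (neg p)) i x = x λ j → p , j , i here
  refute (c ∨ d)        i x = x (refute c (i ∘ left) , refute d (i ∘ right) , _)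

-- The clauses C handed to the last argument are those of a conjunctive normal
-- form of A; that A entails them is all the completeness argument needs.
by-clauses : ∀ (A B : Formula Var) →
             (∀ C → Clause C → ⌜ A ⌝ ⊨ ⌜ C ⌝ → 𝗍 ⟿ C ∨ B) → 𝗍 ⟿ A ∨ B
by-clauses 𝖿 B k = k 𝖿 𝖿 (λ _ _ → id)
-- The conjunctive normal form of `𝗍` is empty, so it only remains to introduce `B` by weakening.
by-clauses 𝗍 B k = ∨-identityʳ⁻¹ ⟫ ∨-mono ⟿-refl (𝖿⟿ B)
by-clauses (atom a) B k = k (atom a) (atom a) (λ _ _ → id)
by-clauses (A₁ ∨ A₂) B k =
  -- `A₂` waits in the side formula while `A₁` is reduced to a clause `C₁`, which then waits while
  -- `A₂` is reduced; hence the order `C₂ ∨ C₁`.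
  by-clauses A₁ (A₂ ∨ B) (λ C₁ c₁ e₁ →
    by-clauses A₂ (C₁ ∨ B) (λ C₂ c₂ e₂ →
      k (C₂ ∨ C₁) (c₂ ∨ c₁)
        (λ O v x (y₂ , y₁ , _) → x (y₁ ∘ e₁ O v , y₂ ∘ e₂ O v , _))
      ⟫ ∨-assocʳ)
    ⟫ ∨-swap)
  ⟫ ∨-assocˡ
by-clauses (A₁ ∧ A₂) B k =
  𝗍⟿𝗍∧𝗍
  ⟫ ∧-mono (by-clauses A₁ B λ C c e → k C c λ O v x → e O v (proj₁ x))
           (by-clauses A₂ B λ C c e → k C c λ O v x → e O v (proj₁ (proj₂ x)))
  ⟫ ∧-∨-switch
  -- Each branch has produced its own copy of the side formula `B`.
  ⟫ ∨-mono ⟿-refl merge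

complete : ∀ (A : Formula Var) → 𝗍 ⊨ ⌜ A ⌝ → 𝗍 ⟿ A
complete A valid =
  by-clauses A 𝖿 (λ C c e →
    clash-⟿ (valid-clause-clash c (λ O v x → e O v (valid O v x))) ⟫ ∨-identityʳ⁻¹)
  ⟫ ∨-identityʳ

separate : 𝗍 ⟿ A ∨ B →
           ∃[ V ] ∃[ U ] (Derivation ｛ ac↑ ｝ ⌜ dual A ⌝ V
                          × Derivation NC V U
                          × Derivation ｛ ac↓ ｝ U ⌜ B ⌝)
separate f with f 𝗍
-- An expansion of a disjunction is a disjunction of expansions, so the postponed contractions fall
-- into those of `A`, dualised to the top, and those of `B`, kept at the bottom.
... | X ∨ Y , x ∨ y , d = ⌜ dual X ⌝ , ⌜ Y ⌝ , contraction↑ x , middle , contraction↓ y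
  where
  open D-Reasoning

  middle : Derivation NC ⌜ dual X ⌝ ⌜ Y ⌝
  middle = begin
    ⌜ dual X ⌝                           ≈⟨ con-𝗍 _ ⟨
    ⦅ 𝗍 , ⌜ dual X ⌝ ⦆                   ≲⟨ con-mono d (single ≈-refl) ⟩
    ⦅ [ ⌜ X ⌝ , ⌜ Y ⌝ ] , ⌜ dual X ⌝ ⦆   ≲⟨ switch ⟩
    [ ⦅ ⌜ X ⌝ , ⌜ dual X ⌝ ⦆ , ⌜ Y ⌝ ]   ≈⟨ dis-cong (con-comm _ _) ≈-refl ⟩
    [ ⦅ ⌜ dual X ⌝ , ⌜ X ⌝ ⦆ , ⌜ Y ⌝ ]   ≲⟨ dis-mono (interaction↑ X) (single ≈-refl) ⟩
    [ 𝖿 , ⌜ Y ⌝ ]                        ≈⟨ dis-𝖿 _ ⟩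
    ⌜ Y ⌝                                ∎

theorem3p33 : (Var : Set) (T R : Structure Var) → Derivation SKS T R →
    ∃[ V ] ∃[ U ] (Derivation ｛ ac↑ ｝ T V
    × Derivation (SKS ∖ (｛ ac↓ ｝ ∪ ｛ ac↑ ｝)) V U
    × Derivation ｛ ac↓ ｝ U R)
theorem3p33 Var T R d =
  let V , U , up , middle , down = separate (complete (nnf (bar T) ∨ nnf R) valid)
  in V , U , single T≈ ⨟ up , middle , down ⨟ single (≈-sym (nnf-≈ R))
  where
  valid : 𝗍 ⊨ ⌜ nnf (bar T) ∨ nnf R ⌝
  -- Soundness carries any `t` to a proof of `R`, which is refuted; this proves the negation of `T`,
  -- refuted in turn.
  valid O v _ (refute-T̄ , refute-R , _) =
    refute-T̄ (proj₁ (≈-sound O v (nnf-≈ (bar T)))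
      λ t → refute-R (proj₁ (≈-sound O v (nnf-≈ R)) (sound O v d t)))

  T≈ : T ≈ ⌜ dual (nnf (bar T)) ⌝
  -- `nnf (bar (bar T))` computes to `dual (nnf (bar T))`.
  T≈ = ≈-trans (≈-sym (bar-bar T)) (nnf-≈ (bar (bar T)))
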